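{- Let $(S,\ast)$ and $(T,\ast')$ be adequate commutative partial semigroups, let $h:S\to T$ be a surjective partial semigroup homomorphism, and let $\tilde h:\beta S\to\beta T$ be the continuous extension of $h$. Suppose $\tilde h$ maps $\delta S$ onto $\delta T$. Then (a) $\tilde h(K(\delta S))=K(\delta T)$; (b) if $A$ is a central set in $S$, then $h(A)$ is a central set in $T$; (c) if $A$ is a central set in $T$, then $h^{ -1}(A)$ is a central set in $S$.
   Context: A partial semigroup is a pair $(S,\ast)$ where $\ast$ is an operation defined on a subset of $S\times S$ such that $(x\ast y)\ast z=x\ast(y\ast z)$ in the sense that if either side is defined, so is the other and they are equal; commutative means $x\ast y=y\ast x$ whenever defined. $\phi_S(s)=\{t: s\ast t\text{ defined}\}$, $\sigma_S(H)=\bigcap_{s\in H}\phi_S(s)$ for finite nonempty $H$; $S$ is adequate if all $\sigma_S(H)\ne\emptyset$. A map $h:S\to T$ is a partial semigroup homomorphism if whenever $y\in\phi_S(x)$, $h(y)\in\phi_T(h(x))$ and $h(x\ast y)=h(x)\ast' h(y)$. $\beta S$ is the Stone–Čech compactification of discrete $S$ (ultrafilters on $S$); $\tilde h(p)=\{B\subseteq T: h^{ -1}(B)\in p\}$. $\delta S=\bigcap_{x\in S}\overline{\phi_S(x)}$, where $\overline{A}=\{p\in\beta S: A\in p\}$, with operation $p\ast q=\{A\subseteq S:\{s: s^{ -1}A\in q\}\in p\}$, $s^{ -1}A=\{t\in\phi_S(s): s\ast t\in A\}$; $\delta S$ is a compact right topological semigroup with smallest two-sided ideal $K(\delta S)$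 (similarly for $T$). $A\subseteq S$ is central if there is an idempotent $p\in K(\delta S)\cap\overline{A}$. -}

module Defs where

open import Level using (Level; suc; _⊔_)
open import Algebra.Bundles using (Semigroup)
open import Algebra.Definitions using (_IdempotentOn_)
open import Data.Empty using (⊥-elim)
open import Data.List.NonEmpty.Base using (List⁺)
open import Data.List.NonEmpty.Relation.Unary.All using (All)
open import Data.Maybe.Base using (Maybe; just; nothing; _>>=_)
open import Data.Product.Base using (Σ; Σ-syntax; ∃-syntax; _×_; _,_; proj₁; proj₂)
open import Data.Sum.Base using (_⊎_; inj₁; inj₂)
open import Relation.Binary.PropositionalEquality.Core
  using (_≡_; refl; sym; trans; subst)
open import Relation.Unary
  using (Pred; _∈_; _∉_; _⊆_; _≐_; _∩_; _⊢_; ∁; Satisfiable)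
open import Relation.Unary.Polymorphic using (∅; U)

private
  variable
    ℓ a b p c r : Level

-- A partial operation is a Maybe-valued one, so _≡_ on Maybe is the Kleene
-- equality "if either side is defined, so is the other and they are equal".
record PartialSemigroup (ℓ : Level) : Set (suc ℓ) where
  infixl 7 _∗_
  field
    Carrier : Set ℓ
    _∗_     : Carrier → Carrier → Maybe Carrier
    assoc   : ∀ x y z → ((x ∗ y) >>= λ u → u ∗ z) ≡ ((y ∗ z) >>= λ v → x ∗ v)

  φ : Carrier → Pred Carrier ℓ
  φ s t = ∃[ u ] s ∗ t ≡ just u

  σ : List⁺ Carrier → Pred Carrier ℓ
  σ H t = All (λ s → t ∈ φ s) H

  Adequate : Set ℓ
  Adequate = ∀ H → Satisfiable (σ H)

  Commutative : Set ℓ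
  Commutative = ∀ x y → x ∗ y ≡ y ∗ x

  infix 8 _⁻¹_
  _⁻¹_ : Carrier → Pred Carrier ℓ → Pred Carrier ℓ
  (s ⁻¹ A) t = ∃[ u ] s ∗ t ≡ just u × u ∈ A

IsHomomorphism : (S T : PartialSemigroup ℓ) →
  (PartialSemigroup.Carrier S → PartialSemigroup.Carrier T) → Set ℓ
IsHomomorphism S T h = ∀ x y {z} → x S.∗ y ≡ just z → h x T.∗ h y ≡ just (h z)
  where
  module S = PartialSemigroup S
  module T = PartialSemigroup T

-- Image of a subset, taken up to a given equality on the codomain.
image : {A : Set a} {B : Set b} → (B → B → Set r) → (A → B) → Pred A p →
  Pred B (a ⊔ r ⊔ p)
image _≈_ f P y = ∃[ x ] x ∈ P × f x ≈ y

-- The points of βX.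
record Ultrafilter (X : Set ℓ) : Set (suc ℓ) where
  field
    sets   : Pred (Pred X ℓ) ℓ
    whole  : U ∈ sets
    proper : ∅ ∉ sets
    upward : ∀ {A B} → A ⊆ B → A ∈ sets → B ∈ sets
    inter  : ∀ {A B} → A ∈ sets → B ∈ sets → A ∩ B ∈ sets
    ultra  : ∀ A → A ∈ sets ⊎ ∁ A ∈ sets

open Ultrafilter

-- Equality of points of βX: the same member sets.
infix 4 _≈_
_≈_ : {X : Set ℓ} → Ultrafilter X → Ultrafilter X → Set (suc ℓ)
p ≈ q = sets p ≐ sets q

closure : {X : Set ℓ} → Pred X ℓ → Pred (Ultrafilter X) ℓ
closure A p = A ∈ sets p

β : {X Y : Set ℓ} → (X → Y) → Ultrafilter X → Ultrafilter Y
β h p = record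
  { sets   = λ B → (h ⊢ B) ∈ sets p
  ; whole  = whole p
  ; proper = proper p
  ; upward = λ A⊆B → upward p λ {x} → A⊆B {h x}
  ; inter  = inter p
  ; ultra  = λ B → ultra p (h ⊢ B)
  }

module _ (S : PartialSemigroup ℓ) where
  open PartialSemigroup S hiding (assoc)

  InDelta : Pred (Ultrafilter Carrier) ℓ
  InDelta p = ∀ x → p ∈ closure (φ x)

  private
    just-injective : ∀ {x y : Carrier} → just x ≡ just y → x ≡ y
    just-injective refl = refl

    assocʳ : ∀ x y z {u w} → x ∗ y ≡ just u → u ∗ z ≡ just w →
      ∃[ v ] y ∗ z ≡ just v × x ∗ v ≡ just w
    assocʳ x y z {u} xy uz with y ∗ z | PartialSemigroup.assoc S x y z
    ... | just v  | eq rewrite xy = v , refl , trans (sym eq) uz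
    ... | nothing | eq rewrite xy with () ← trans (sym eq) uz

    assocˡ : ∀ x y z {v w} → y ∗ z ≡ just v → x ∗ v ≡ just w →
      ∃[ u ] x ∗ y ≡ just u × u ∗ z ≡ just w
    assocˡ x y z {v} yz xv with x ∗ y | PartialSemigroup.assoc S x y z
    ... | just u  | eq rewrite yz = u , refl , trans eq xv
    ... | nothing | eq rewrite yz with () ← trans eq xv

    mono : ∀ s {A B} → A ⊆ B → s ⁻¹ A ⊆ s ⁻¹ B
    mono s A⊆B (u , e , a) = u , e , A⊆B a

  product : (p q : Ultrafilter Carrier) → q ∈ InDelta → Ultrafilter Carrier
  product p q q∈δ = record
    { sets   = λ A → (λ s → s ⁻¹ A ∈ sets q) ∈ sets p
    ; whole  = upward p
        (λ {s} _ → upward q (λ (u , e) → u , e , _) (q∈δ s)) (whole p)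
    ; proper = λ h → proper p (upward p
        (λ k → ⊥-elim (proper q (upward q (λ (_ , _ , f) → f) k))) h)
    ; upward = λ A⊆B → upward p λ {s} → upward q (mono s A⊆B)
    ; inter  = λ {A} {B} hA hB → upward p
        (λ {s} (kA , kB) → upward q
          (λ ((u , e , m) , (v , e′ , n)) →
            u , e , m , subst B (just-injective (trans (sym e′) e)) n)
          (inter q kA kB))
        (inter p hA hB)
    ; ultra  = λ A → ultra-product A (ultra p (λ s → s ⁻¹ A ∈ sets q))
    }
    where
    complement : ∀ A s → s ⁻¹ A ∉ sets q → s ⁻¹ ∁ A ∈ sets q
    complement A s ∉q with ultra q (s ⁻¹ A)
    ... | inj₁ ∈q = ⊥-elim (∉q ∈q)
    ... | inj₂ ∁∈q = upward q
      (λ ((u , e) , k) → u , e , λ m → k (u , e , m)) (inter q (q∈δ s) ∁∈q)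

    ultra-product : ∀ A → let P = λ s → s ⁻¹ A ∈ sets q in
      P ∈ sets p ⊎ ∁ P ∈ sets p →
      P ∈ sets p ⊎ (λ s → s ⁻¹ ∁ A ∈ sets q) ∈ sets p
    ultra-product A (inj₁ h) = inj₁ h
    ultra-product A (inj₂ h) = inj₂ (upward p (λ {s} → complement A s) h)

  δ : Semigroup (suc ℓ) (suc ℓ)
  δ = record
    { Carrier = Σ (Ultrafilter Carrier) InDelta
    ; _≈_     = λ p q → proj₁ p ≈ proj₁ q
    ; _∙_     = _·_
    ; isSemigroup = record
      { isMagma = record
        { isEquivalence = record
          { refl  = (λ m → m) , (λ m → m)
          ; sym   = λ (f , g) → g , f
          ; trans = λ (f , g) (f′ , g′) → (λ m → f′ (f m)) , (λ m → g (g′ m))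
          }
        ; ∙-cong = λ {p} {p′} {q} {q′} (f , g) (f′ , g′) →
            (λ m → f (upward (proj₁ p) f′ m)) ,
            (λ m → g (upward (proj₁ p′) g′ m))
        }
      ; assoc = λ p q r →
          (λ m → upward (proj₁ p)
            (λ {x} k → upward (proj₁ q)
              (λ {y} (u , xy , n) → upward (proj₁ r)
                (λ {z} (w , uz , mem) →
                  let (v , yz , xv) = assocʳ x y z xy uz
                  in v , yz , w , xv , mem) n) k) m) ,
          (λ m → upward (proj₁ p)
            (λ {x} k → upward (proj₁ q)
              (λ {y} (n , (u , xy)) → u , xy , upward (proj₁ r)
                (λ {z} (v , yz , w , xv , mem) →
                  let (u′ , xy′ , uz) = assocˡ x y z yz xv
                  in w , subst (λ t → t ∗ z ≡ just w)
                           (just-injective (trans (sym xy′) xy)) uz , mem) n)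
              (inter (proj₁ q) k (proj₂ q x))) m)
      }
    }
    where
    _·_ : Σ (Ultrafilter Carrier) InDelta → Σ (Ultrafilter Carrier) InDelta →
      Σ (Ultrafilter Carrier) InDelta
    (p , p∈δ) · (q , q∈δ) = product p q q∈δ , λ x → upward p
      (λ {s} (u , xs) → upward q
        (λ {t} (w , ut) → let (v , st , xv) = assocʳ x s t xs ut
                          in v , st , w , xv)
        (q∈δ u))
      (p∈δ x)

module _ (G : Semigroup c r) where
  private module G = Semigroup G

  record IsIdeal (I : Pred G.Carrier p) : Set (c ⊔ r ⊔ p) where
    field
      nonempty : Satisfiable I
      respects : ∀ {x y} → x G.≈ y → x ∈ I → y ∈ I
      left     : ∀ s {x} → x ∈ I → s G.∙ x ∈ I
      right    : ∀ s {x} → x ∈ I → x G.∙ s ∈ I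

  IsSmallestIdeal : Pred (Pred G.Carrier (c ⊔ r)) (suc (c ⊔ r))
  IsSmallestIdeal I = IsIdeal I × (∀ (J : Pred G.Carrier (c ⊔ r)) → IsIdeal J → I ⊆ J)

  -- A smallest ideal is unique, so this is a definite description of it.
  SmallestIdeal : Pred G.Carrier (suc (c ⊔ r))
  SmallestIdeal x = ∃[ I ] IsSmallestIdeal I × x ∈ I

module _ (S : PartialSemigroup ℓ) where
  open PartialSemigroup S using (Carrier)

  -- K(δS) as a subset of βS.
  Kδ : Pred (Ultrafilter Carrier) (suc (suc ℓ))
  Kδ p = Σ[ p∈δ ∈ InDelta S p ] (p , p∈δ) ∈ SmallestIdeal (δ S)

  Central : Pred (Pred Carrier ℓ) (suc (suc ℓ))
  Central A = ∃[ p ] p ∈ SmallestIdeal (δ S)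
                   × _IdempotentOn_ (Semigroup._≈_ (δ S)) (Semigroup._∙_ (δ S)) p
                   × proj₁ p ∈ closure A

{-# OPTIONS --safe #-}

-- Excluded middle for all types is a choice operator, hence yields Zorn's lemma.
-- Closed subsets of δS correspond to filters on S, so maximal filters provide
-- ultrafilters, minimal closed left ideals and minimal closed subsemigroups of δS.
-- A point m of a minimal closed left ideal satisfies m ∈ δS ∙ x ∙ m for all x, so
-- every ideal contains m, and δS ∙ m ∙ δS is the smallest ideal.  The map induced
-- by h is a surjective homomorphism δS → δT; images and preimages of ideals are
-- ideals, whence (a) and (b).  For (c), given an idempotent q ∈ K(δT), pick
-- p ∈ K(δS) above q: the points of δS ∙ p above q form a closed subsemigroup, which
-- contains an idempotent by Ellis' theorem.
module Submission where

open import Level using (Level; 0ℓ; Lift; lift; lower; suc; _⊔_)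
open import Algebra.Bundles using (Semigroup)
open import Algebra.Definitions using (_IdempotentOn_)
open import Axiom.ExcludedMiddle using (ExcludedMiddle)
open import Axiom.Extensionality.Propositional using (Extensionality)
open import Data.Bool.Base using (Bool; true; false; T)
open import Data.Empty using (⊥-elim)
open import Data.Product.Base using (Σ; ∃-syntax; _×_; _,_; proj₁; proj₂)
open import Data.Sum.Base using (_⊎_; inj₁; inj₂)
open import Function.Base using (_∘_)
open import Function.Definitions using (Surjective)
open import Relation.Binary.PropositionalEquality.Core using (_≡_; refl)
open import Relation.Nullary using (¬_; yes; no; isYes)
open import Relation.Nullary.Decidable.Core using (toWitness; fromWitness)
open import Relation.Unary
  using (Pred; _∈_; _∉_; _⊆_; _≐_; _∩_; _⊢_; ∁; Satisfiable)
open import Relation.Unary.Polymorphic using (∅; U)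
open import Defs

open Ultrafilter

private
  variable
    a c k ℓ p r : Level

-- Smallest ideals

module _ (G : Semigroup c r) where
  open Semigroup G renaming (_≈_ to _∼_)
  open import Relation.Binary.Reasoning.Setoid setoid

  -- By hypothesis `m` is a left multiple of every `x ∙ m`. So an ideal containing some `x` contains
  -- `x ∙ m`, then `m`, then all `u ∙ m ∙ v`.
  smallestIdeal-generatedBy : ∀ m → (∀ x → ∃[ s ] s ∙ (x ∙ m) ∼ m) →
    IsSmallestIdeal G (λ y → ∃[ u ] ∃[ v ] u ∙ m ∙ v ∼ y)
  smallestIdeal-generatedBy m minimal = isIdeal , smallest
    where
    isIdeal : IsIdeal G (λ y → ∃[ u ] ∃[ v ] u ∙ m ∙ v ∼ y)
    isIdeal = record
      { nonempty = m ∙ m ∙ m , m , m , Semigroup.refl G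
      ; respects = λ { x≈y (u , v , e) → u , v , trans e x≈y }
      ; left     = λ { s {x} (u , v , e) → s ∙ u , v , (begin
          s ∙ u ∙ m ∙ v    ≈⟨ ∙-congʳ (assoc s u m) ⟩
          s ∙ (u ∙ m) ∙ v  ≈⟨ assoc s (u ∙ m) v ⟩
          s ∙ (u ∙ m ∙ v)  ≈⟨ ∙-congˡ e ⟩
          s ∙ x            ∎) }
      ; right    = λ { s {x} (u , v , e) → u , v ∙ s , (begin
          u ∙ m ∙ (v ∙ s)  ≈⟨ assoc (u ∙ m) v s ⟨
          u ∙ m ∙ v ∙ s    ≈⟨ ∙-congʳ e ⟩
          x ∙ s            ∎) }
      }

    smallest : ∀ (J : Pred Carrier _) → IsIdeal G J →
      (λ y → ∃[ u ] ∃[ v ] u ∙ m ∙ v ∼ y) ⊆ J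
    smallest J J-ideal (u , v , e) = respects e (right v (left u m∈J))
      where
      open IsIdeal J-ideal
      m∈J : m ∈ J
      m∈J with x , x∈J ← nonempty with s , e ← minimal x =
        respects e (left s (right m x∈J))

module SurjectiveHomomorphism (G H : Semigroup c r) where
  private
    module G = Semigroup G
    module H = Semigroup H

  module _
    (f      : G.Carrier → H.Carrier)
    (f-cong : ∀ {x y} → x G.≈ y → f x H.≈ f y)
    (f-homo : ∀ x y → f (x G.∙ y) H.≈ f x H.∙ f y)
    (f-onto : ∀ y → ∃[ x ] f x H.≈ y)
    where

    image-isIdeal : ∀ {I : Pred G.Carrier (c ⊔ r)} → IsIdeal G I →
      IsIdeal H (image H._≈_ f I)
    image-isIdeal I-ideal = record
      { nonempty = let x , x∈I = nonempty in f x , x , x∈I , H.refl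
      ; respects = λ { y≈z (x , x∈I , e) → x , x∈I , H.trans e y≈z }
      ; left     = λ { t (x , x∈I , e) → let s , e′ = f-onto t in
          s G.∙ x , left s x∈I , H.trans (f-homo s x) (H.∙-cong e′ e) }
      ; right    = λ { t (x , x∈I , e) → let s , e′ = f-onto t in
          x G.∙ s , right s x∈I , H.trans (f-homo x s) (H.∙-cong e e′) }
      }
      where open IsIdeal I-ideal

    preimage-isIdeal : ∀ {J : Pred H.Carrier p} → IsIdeal H J → IsIdeal G (f ⊢ J)
    preimage-isIdeal J-ideal = record
      { nonempty = let y , y∈J = nonempty ; x , e = f-onto y in
          x , respects (H.sym e) y∈J
      ; respects = λ x≈y → respects (f-cong x≈y)
      ; left     = λ s {x} y∈J → respects (H.sym (f-homo s x)) (left (f s) y∈J)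
      ; right    = λ s {x} y∈J → respects (H.sym (f-homo x s)) (right (f s) y∈J)
      }
      where open IsIdeal J-ideal

    -- An ideal of `H` pulls back to an ideal of `G`, which contains `I`.
    image-isSmallestIdeal : ∀ {I} → IsSmallestIdeal G I →
      IsSmallestIdeal H (image H._≈_ f I)
    image-isSmallestIdeal (I-ideal , I-smallest) =
      image-isIdeal I-ideal ,
      λ { J J-ideal (x , x∈I , e) → IsIdeal.respects J-ideal e
            (I-smallest (f ⊢ J) (preimage-isIdeal J-ideal) x∈I) }

-- Filters

-- Ultrafilters are maximal: if `A` is in `q` but not in `p`, then `∁ A` is in `p`, hence in `q`,
-- against properness.
≈-of-⊆ : {X : Set ℓ} {p q : Ultrafilter X} → sets p ⊆ sets q → p ≈ q
≈-of-⊆ {p = p} {q = q} p⊆q = p⊆q , q⊆p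
  where
  q⊆p : sets q ⊆ sets p
  q⊆p {A} A∈q with ultra p A
  ... | inj₁ A∈p  = A∈p
  ... | inj₂ ∁A∈p = ⊥-elim (proper q
    (upward q (λ (x∈A , x∉A) → ⊥-elim (x∉A x∈A)) (inter q A∈q (p⊆q ∁A∈p))))

-- The level of `F` is free because intersections of families of ultrafilters live one level above
-- the ultrafilters.
record IsFilter {X : Set ℓ} (F : Pred (Pred X ℓ) k) : Set (suc ℓ ⊔ k) where
  field
    full       : U ∈ F
    nontrivial : ∅ ∉ F
    expand     : ∀ {A B} → A ⊆ B → A ∈ F → B ∈ F
    meet       : ∀ {A B} → A ∈ F → B ∈ F → A ∩ B ∈ F

isFilter-respects : {X : Set ℓ} {F : Pred (Pred X ℓ) k} {G : Pred (Pred X ℓ) p} →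
  F ≐ G → IsFilter F → IsFilter G
isFilter-respects (F⊆G , G⊆F) F-filter = record
  { full       = F⊆G full
  ; nontrivial = λ ∅∈G → nontrivial (G⊆F ∅∈G)
  ; expand     = λ A⊆B A∈G → F⊆G (expand A⊆B (G⊆F A∈G))
  ; meet       = λ A∈G B∈G → F⊆G (meet (G⊆F A∈G) (G⊆F B∈G))
  }
  where open IsFilter F-filter

module Classical (em : ∀ {ℓ} → ExcludedMiddle ℓ)
                 (ext : ∀ {a b} → Extensionality a b) where

  -- Excluded middle acts as resizing: `T ∘ ⟦ F ⟧` is equivalent to `F` but has level zero.
  ⟦_⟧ : {Y : Set a} → Pred Y p → Y → Bool
  ⟦ F ⟧ y = isYes (em {P = F y})

  ⟦⟧-to : {Y : Set a} (F : Pred Y p) → T ∘ ⟦ F ⟧ ⊆ F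
  ⟦⟧-to F {y} = toWitness {a? = em {P = F y}}

  ⟦⟧-from : {Y : Set a} (F : Pred Y p) → F ⊆ T ∘ ⟦ F ⟧
  ⟦⟧-from F {y} = fromWitness {a? = em {P = F y}}

  -- Zorn's lemma for Bool-valued subsets: they form a small type on which
  -- inclusion is antisymmetric up to _≡_.

  infix 4 _⊑_
  _⊑_ : {Y : Set a} → (Y → Bool) → (Y → Bool) → Set a
  F ⊑ G = T ∘ F ⊆ T ∘ G

  ⊑-antisym : {Y : Set a} {F G : Y → Bool} → F ⊑ G → G ⊑ F → F ≡ G
  ⊑-antisym {F = F} {G} F⊑G G⊑F = ext λ y → bool (F y) (G y) F⊑G G⊑F
    where
    bool : ∀ b b′ → (T b → T b′) → (T b′ → T b) → b ≡ b′
    bool true  true  _ _ = refl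
    bool false false _ _ = refl
    bool true  false f _ = ⊥-elim (f _)
    bool false true  _ g = ⊥-elim (g _)

  Members : {Y : Set a} → Pred (Y → Bool) 0ℓ → Pred Y a
  Members C y = ∃[ F ] F ∈ C × T (F y)

  ⋃ : {Y : Set a} → Pred (Y → Bool) 0ℓ → Y → Bool
  ⋃ C = ⟦ Members C ⟧

  Chain : {Y : Set a} → Pred (Y → Bool) 0ℓ → Set a
  Chain C = ∀ {F G} → F ∈ C → G ∈ C → F ⊑ G ⊎ G ⊑ F

  module Zorn {Y : Set a} (P : Pred (Y → Bool) p)
    (P-⋃ : ∀ C → Satisfiable C → C ⊆ P → Chain C → ⋃ C ∈ P)
    {F₀ : Y → Bool} (F₀∈P : F₀ ∈ P) where

    private
      Improvement : (Y → Bool) → Set (a ⊔ p)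
      Improvement F = ∃[ G ] G ∈ P × F ⊑ G × ¬ G ⊑ F

      improve : (Y → Bool) → Y → Bool
      improve F with em {P = Improvement F}
      ... | yes (G , _) = G
      ... | no  _       = F

      improve-⊒ : ∀ F → F ⊑ improve F
      improve-⊒ F with em {P = Improvement F}
      ... | yes (_ , _ , F⊑G , _) = F⊑G
      ... | no  _                 = λ m → m

      improve-P : ∀ {F} → F ∈ P → improve F ∈ P
      improve-P {F} F∈P with em {P = Improvement F}
      ... | yes (_ , G∈P , _) = G∈P
      ... | no  _             = F∈P

      improve-fixed : ∀ F → improve F ⊑ F → ¬ Improvement F
      improve-fixed F fixed better with em {P = Improvement F}
      ... | yes (_ , _ , _ , G⋢F) = G⋢F fixed
      ... | no  none              = none better

      -- The tower of the Bourbaki-Witt argument. Letting `join` range over families of level zero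
      -- keeps the definition predicative; resizing recovers all families.
      data Tower : Pred (Y → Bool) (suc 0ℓ ⊔ a) where
        base : Tower F₀
        next : ∀ {F} → Tower F → Tower (improve F)
        join : ∀ C → Satisfiable C → C ⊆ Tower → Tower (⋃ C)

      base-⊑ : ∀ {F} → Tower F → F₀ ⊑ F
      base-⊑ base       m = m
      base-⊑ (next t)   m = improve-⊒ _ (base-⊑ t m)
      base-⊑ (join C (F , F∈C) C⊆) m =
        ⟦⟧-from (Members C) (F , F∈C , base-⊑ (C⊆ F∈C) m)

      -- Sharper than comparability: no `F` lies strictly between `G` and `improve G`. This form
      -- survives the induction through `next`.
      Comparable : (F G : Y → Bool) → Set a
      Comparable F G = F ⊑ G ⊎ improve G ⊑ F

      comparable-next : ∀ {F G} → Comparable F G → Comparable G F →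
        Comparable (improve F) G
      comparable-next (inj₂ G′⊑F) _           = inj₂ λ m → improve-⊒ _ (G′⊑F m)
      comparable-next (inj₁ _)   (inj₂ F′⊑G) = inj₁ F′⊑G
      comparable-next {F} {G} (inj₁ F⊑G) (inj₁ G⊑F)
        with refl ← ⊑-antisym {F = F} {G} F⊑G G⊑F = inj₂ λ m → m

      -- Either some member of `C` contains `improve G`, and then so does the union, or every member
      -- lies below `G`.
      comparable-join : ∀ C {G} → (∀ {F} → F ∈ C → Comparable F G) →
        Comparable (⋃ C) G
      comparable-join C {G} cmp with em {P = ∃[ F ] F ∈ C × improve G ⊑ F}
      ... | yes (F , F∈C , G′⊑F) = inj₂ λ m →
        ⟦⟧-from (Members C) (F , F∈C , G′⊑F m)
      ... | no  none = inj₁ λ m → below (⟦⟧-to (Members C) m)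
        where
        below : Members C ⊆ T ∘ G
        below (F , F∈C , m) with cmp F∈C
        ... | inj₁ F⊑G  = F⊑G m
        ... | inj₂ G′⊑F = ⊥-elim (none (F , F∈C , G′⊑F))

      -- The `next` case of `compare` needs both orders of comparison. Once `F` is compared with the
      -- whole tower, the reverse order follows by induction on `G`.
      flip-comparable : ∀ {F G} → Tower F → (∀ {G} → Tower G → Comparable F G) →
        Tower G → Comparable G F
      flip-comparable tF cmp base          = inj₁ (base-⊑ tF)
      flip-comparable tF cmp (next t)      =
        comparable-next (flip-comparable tF cmp t) (cmp t)
      flip-comparable tF cmp (join C _ C⊆) =
        comparable-join C λ F∈C → flip-comparable tF cmp (C⊆ F∈C)

      compare : ∀ {F G} → Tower F → Tower G → Comparable F G
      compare base          tG = inj₁ (base-⊑ tG)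
      compare (next t)      tG =
        comparable-next (compare t tG) (flip-comparable t (compare t) tG)
      compare (join C _ C⊆) tG = comparable-join C λ F∈C → compare (C⊆ F∈C) tG

      total : ∀ {F G} → Tower F → Tower G → F ⊑ G ⊎ G ⊑ F
      total tF tG with compare tF tG
      ... | inj₁ F⊑G  = inj₁ F⊑G
      ... | inj₂ G′⊑F = inj₂ λ m → G′⊑F (improve-⊒ _ m)

      Tower-P : ∀ {F} → Tower F → F ∈ P
      Tower-P base           = F₀∈P
      Tower-P (next t)       = improve-P (Tower-P t)
      Tower-P (join C ne C⊆) = P-⋃ C ne (λ F∈C → Tower-P (C⊆ F∈C))
        λ F∈C G∈C → total (C⊆ F∈C) (C⊆ G∈C)

    opaque
      zorn : ∃[ M ] F₀ ⊑ M × M ∈ P × (∀ G → G ∈ P → M ⊑ G → G ⊑ M)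
      zorn = ⋃ C , base-⊑ top , Tower-P top , maximal
        where
        -- Resized to level zero, the tower is itself a family that `join` accepts, so its union is
        -- its largest member.
        C : Pred (Y → Bool) 0ℓ
        C = T ∘ ⟦ Tower ⟧

        top : Tower (⋃ C)
        top = join C (F₀ , ⟦⟧-from Tower base) (⟦⟧-to Tower)

        maximal : ∀ G → G ∈ P → ⋃ C ⊑ G → G ⊑ ⋃ C
        maximal G G∈P M⊑G with em {P = G ⊑ ⋃ C}
        ... | yes G⊑M = G⊑M
        -- The tower contains `improve (⋃ C)`, which is therefore below `⋃ C`; so `⋃ C` has no
        -- improvement.
        ... | no  G⋢M = ⊥-elim (improve-fixed (⋃ C)
          (λ m → ⟦⟧-from (Members C) (_ , ⟦⟧-from Tower (next top) , m))
          (G , G∈P , M⊑G , G⋢M))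

  -- Extension of filters to ultrafilters

  ⋃-isFilter : {X : Set ℓ} (C : Pred (Pred X ℓ → Bool) 0ℓ) → Satisfiable C →
    (∀ {F} → F ∈ C → IsFilter (T ∘ F)) → Chain C → IsFilter (T ∘ ⋃ C)
  ⋃-isFilter C (F₀ , F₀∈C) filters chain =
    isFilter-respects (⟦⟧-from (Members C) , ⟦⟧-to (Members C)) record
      { full       = F₀ , F₀∈C , full (filters F₀∈C)
      ; nontrivial = λ (_ , F∈C , m) → nontrivial (filters F∈C) m
      ; expand     = λ A⊆B (F , F∈C , m) → F , F∈C , expand (filters F∈C) A⊆B m
      ; meet       = meet-Members
      }
    where
    open IsFilter
    meet-Members : ∀ {A B} → A ∈ Members C → B ∈ Members C → A ∩ B ∈ Members C
    meet-Members (F , F∈C , m) (G , G∈C , n) with chain F∈C G∈C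
    ... | inj₁ F⊑G = G , G∈C , meet (filters G∈C) (F⊑G m) n
    ... | inj₂ G⊑F = F , F∈C , meet (filters F∈C) m (G⊑F n)

  opaque
    -- A maximal filter `M` decides every `A`: either a member of `M` misses `A`, so `∁ A` is in
    -- `M`, or `M` and `A` generate a filter, which maximality puts inside `M`.
    ultrafilter-extending : {X : Set ℓ} {F : Pred (Pred X ℓ) k} → IsFilter F →
      ∃[ p ] F ⊆ sets {X = X} p
    ultrafilter-extending {ℓ = ℓ} {X = X} {F = F} F-filter = fromMaximal
      (Zorn.zorn (λ G → IsFilter (T ∘ G))
        (λ C ne C⊆P → ⋃-isFilter C ne C⊆P)
        (isFilter-respects (⟦⟧-from F , ⟦⟧-to F) F-filter))
      where
      fromMaximal :
        ∃[ M ] ⟦ F ⟧ ⊑ M × IsFilter (T ∘ M) × (∀ G → IsFilter (T ∘ G) → M ⊑ G → G ⊑ M) →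
        ∃[ p ] F ⊆ sets {X = X} p
      fromMaximal (M , F⊑M , M-filter , maximal) = record
        { sets   = λ A → Lift ℓ (T (M A))
        ; whole  = lift full
        ; proper = λ ∅∈M → nontrivial (lower ∅∈M)
        ; upward = λ A⊆B A∈M → lift (expand A⊆B (lower A∈M))
        ; inter  = λ A∈M B∈M → lift (meet (lower A∈M) (lower B∈M))
        ; ultra  = decide
        } , λ A∈F → lift (F⊑M (⟦⟧-from F A∈F))
        where
        open IsFilter M-filter
        decide : ∀ A → Lift ℓ (T (M A)) ⊎ Lift ℓ (T (M (∁ A)))
        decide A with em {P = ∃[ E ] T (M E) × E ∩ A ⊆ ∅ {ℓ = ℓ}}
        ... | yes (E , E∈M , disjoint) = inj₂ (lift
          (expand (λ {x} x∈E x∈A → ⊥-elim (lower (disjoint {x} (x∈E , x∈A)))) E∈M))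
        ... | no  meets = inj₁ (lift (maximal ⟦ M+A ⟧
          (isFilter-respects (⟦⟧-from M+A , ⟦⟧-to M+A) M+A-filter)
          (λ {B} B∈M → ⟦⟧-from M+A (B , B∈M , proj₁))
          (⟦⟧-from M+A (U , full , proj₂))))
          where
          M+A : Pred (Pred X ℓ) (suc ℓ)
          M+A B = ∃[ E ] T (M E) × E ∩ A ⊆ B

          M+A-filter : IsFilter M+A
          M+A-filter = record
            { full       = U , full , λ _ → _
            ; nontrivial = meets
            ; expand     = λ B⊆B′ (E , E∈M , s) → E , E∈M , λ x → B⊆B′ (s x)
            ; meet       = λ (E , E∈M , s) (E′ , E′∈M , s′) → E ∩ E′ , meet E∈M E′∈M ,
                λ ((x∈E , x∈E′) , x∈A) → s (x∈E , x∈A) , s′ (x∈E′ , x∈A)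
            }

  -- Closed subsets of δS

  module Delta {ℓ : Level} (S : PartialSemigroup ℓ) where
    open PartialSemigroup S using (φ; _⁻¹_) renaming (Carrier to X)
    open Semigroup (δ S) using (_∙_; assoc; ∙-congˡ)
      renaming (Carrier to Point; _≈_ to _≋_; refl to ≋-refl; sym to ≋-sym;
                trans to ≋-trans)

    infix 4 _ε_
    _ε_ : Pred X ℓ → Point → Set ℓ
    A ε p = A ∈ sets (proj₁ p)

    Subset : Set (suc (suc ℓ))
    Subset = Pred Point (suc ℓ)

    ⋂ : Subset → Pred (Pred X ℓ) (suc ℓ)
    ⋂ D A = ∀ {p} → p ∈ D → A ε p

    hull : Pred (Pred X ℓ) k → Pred Point (suc ℓ ⊔ k)
    hull F p = ∀ {A} → A ∈ F → A ε p

    -- `hull (⋂ D)` is the topological closure of `D` in δS, since the sets `closure A` form a base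
    -- of clopen sets.
    Closed : Subset → Set (suc ℓ)
    Closed D = hull (⋂ D) ⊆ D

    closed-respects : ∀ {D} → Closed D → ∀ {p q} → p ≋ q → p ∈ D → q ∈ D
    closed-respects D-closed (p⊆q , _) p∈D = D-closed λ A∈⋂ → p⊆q (A∈⋂ p∈D)

    ∩-closed : ∀ {D E} → Closed D → Closed E → Closed (D ∩ E)
    ∩-closed D-closed E-closed m =
      D-closed (λ A∈⋂ → m λ (p∈D , _) → A∈⋂ p∈D) ,
      E-closed (λ A∈⋂ → m λ (_ , p∈E) → A∈⋂ p∈E)

    ⋂-isFilter : ∀ {D} → Satisfiable D → IsFilter (⋂ D)
    ⋂-isFilter (p , p∈D) = record
      { full       = λ {q} _ → whole (proj₁ q)
      ; nontrivial = λ ∅∈⋂ → proper (proj₁ p) (∅∈⋂ p∈D)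
      ; expand     = λ A⊆B A∈⋂ {q} q∈D → upward (proj₁ q) A⊆B (A∈⋂ q∈D)
      ; meet       = λ A∈⋂ B∈⋂ {q} q∈D → inter (proj₁ q) (A∈⋂ q∈D) (B∈⋂ q∈D)
      }

    φ∈⋂ : ∀ D x → φ x ∈ ⋂ D
    φ∈⋂ D x {p} _ = proj₂ p x

    opaque
      -- Compactness of δS: an ultrafilter extending `F` contains every `φ x`, so it is a point of
      -- δS.
      hull-satisfiable : {F : Pred (Pred X ℓ) k} → IsFilter F → (∀ x → φ x ∈ F) →
        Satisfiable (hull F)
      hull-satisfiable F-filter φ∈F with p , F⊆p ← ultrafilter-extending F-filter =
        (p , λ x → F⊆p (φ∈F x)) , F⊆p

    _∙⟨_⟩ : Subset → Point → Subset
    (D ∙⟨ x ⟩) q = ∃[ s ] s ∈ D × s ∙ x ≋ q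

    -- The maps s ↦ s ∙ x are continuous and δS is compact.
    ∙⟨⟩-closed : ∀ {D} → Closed D → ∀ x → Closed (D ∙⟨ x ⟩)
    ∙⟨⟩-closed {D} D-closed x {q} q∈hull = fromPoint (hull-satisfiable G-filter
        λ y → φ y , U , (λ {s} → φ∈⋂ D y {s}) , whole (proj₁ q) , proj₁)
      where
      translate : Pred X ℓ → Pred X ℓ
      translate A s = s ⁻¹ A ∈ sets (proj₁ x)

      -- The filter generated by `⋂ D` and the preimages of members of `q` under `s ↦ s ∙ x`. A
      -- point of its hull lies in `D` and is sent to `q`.
      G : Pred (Pred X ℓ) (suc ℓ)
      G B = ∃[ E ] ∃[ A ] E ∈ ⋂ D × A ε q × E ∩ translate A ⊆ B

      G-proper : ∅ ∉ G
      G-proper (E , A , E∈⋂ , A∈q , disjoint) = proper (proj₁ q) (upward (proj₁ q)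
          (λ (y∈A , y∉A) → ⊥-elim (y∉A y∈A))
          (inter (proj₁ q) A∈q (q∈hull λ {r} → ∁A∈⋂ {r})))
        where
        -- As `E` misses `translate A`, no `s` in `D` has `A` in `s ∙ x`; being a limit of such
        -- points, `q` would contain `∁ A` as well as `A`.
        ∁A∈⋂ : ∁ A ∈ ⋂ (D ∙⟨ x ⟩)
        ∁A∈⋂ (s , s∈D , e , _) with ultra (proj₁ (s ∙ x)) A
        ... | inj₂ ∁A∈sx = e ∁A∈sx
        ... | inj₁ A∈sx  = ⊥-elim (proper (proj₁ s)
          (upward (proj₁ s) disjoint (inter (proj₁ s) (E∈⋂ {s} s∈D) A∈sx)))

      G-filter : IsFilter G
      G-filter = record
        { full       = U , U , (λ {s} _ → whole (proj₁ s)) , whole (proj₁ q) , λ _ → _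
        ; nontrivial = G-proper
        ; expand     = λ B⊆B′ (E , A , E∈⋂ , A∈q , i) → E , A , (λ {s} → E∈⋂ {s}) , A∈q ,
            λ m → B⊆B′ (i m)
        ; meet       = λ (E , A , E∈⋂ , A∈q , i) (E′ , A′ , E′∈⋂ , A′∈q , i′) →
            E ∩ E′ , A ∩ A′ ,
            (λ {s} s∈D → inter (proj₁ s) (E∈⋂ {s} s∈D) (E′∈⋂ {s} s∈D)) ,
            inter (proj₁ q) A∈q A′∈q ,
            λ ((y∈E , y∈E′) , m) →
              i (y∈E , upward (proj₁ x) (λ (u , e , v , _) → u , e , v) m) ,
              i′ (y∈E′ , upward (proj₁ x) (λ (u , e , _ , v) → u , e , v) m)
        }

      fromPoint : Satisfiable (hull G) → q ∈ D ∙⟨ x ⟩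
      fromPoint (s , s∈hull) = s ,
        D-closed (λ {A} A∈⋂ → s∈hull
          (A , U , (λ {t} → A∈⋂ {t}) , whole (proj₁ q) , proj₁)) ,
        ≋-sym {q} {s ∙ x} (≈-of-⊆ {p = proj₁ q} {proj₁ (s ∙ x)} λ {A} A∈q → s∈hull
          (U , A , (λ {t} _ → whole (proj₁ t)) , A∈q , proj₂))

    -- Minimal closed left ideals and subsemigroups; idempotents

    stabilizer : Point → Subset
    stabilizer x s = s ∙ x ≋ x

    -- For `A` in `x`, the set of all `s` with `s ⁻¹ A` in `x` belongs to every stabilizing point,
    -- hence to every limit of such points.
    stabilizer-closed : ∀ x → Closed (stabilizer x)
    stabilizer-closed x {s} s∈hull =
      ≋-sym {x} {s ∙ x} (≈-of-⊆ {p = proj₁ x} {proj₁ (s ∙ x)}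
        λ A∈x → s∈hull λ (_ , x⊆) → x⊆ A∈x)

    -- Closed sets stable for Φ = U are left ideals, for Φ = ∅ subsemigroups.
    Stable : Subset → Pred Point k → Set (suc ℓ ⊔ k)
    Stable Φ D = ∀ s x → s ∈ Φ ⊎ s ∈ D → x ∈ D → s ∙ x ∈ D

    opaque
      -- `hull` reverses inclusion, so a maximal filter among those containing all `φ x` and having
      -- a stable hull yields a minimal closed stable set.
      minimalClosed : ∀ Φ D₀ → Closed D₀ → Satisfiable D₀ → Stable Φ D₀ →
        ∃[ D ] D ⊆ D₀ × Satisfiable D × Closed D × Stable Φ D ×
          (∀ E → E ⊆ D → Satisfiable E → Closed E → Stable Φ E → D ⊆ E)
      minimalClosed Φ D₀ D₀-closed D₀-sat D₀-stable =
        fromMaximal (Zorn.zorn P P-⋃ (fromClosed D₀-closed D₀-sat D₀-stable))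
        where
        P : Pred (Pred X ℓ → Bool) (suc ℓ)
        P F = IsFilter (T ∘ F) × (∀ x → T (F (φ x))) × Stable Φ (hull (T ∘ F))

        P-⋃ : ∀ C → Satisfiable C → C ⊆ P → Chain C → ⋃ C ∈ P
        P-⋃ C (F₀ , F₀∈C) C⊆P chain =
          ⋃-isFilter C (F₀ , F₀∈C) (λ F∈C → proj₁ (C⊆P F∈C)) chain ,
          (λ x → ⟦⟧-from (Members C) (F₀ , F₀∈C , proj₁ (proj₂ (C⊆P F₀∈C)) x)) ,
          -- The hull of the union lies in the hull of each filter of the chain, so stability is
          -- checked one filter at a time.
          λ s x s∈ x∈ A∈⋃ → stable s x s∈ x∈ (⟦⟧-to (Members C) A∈⋃)
          where
          hull-⊆ : ∀ {F} → F ∈ C → hull (T ∘ ⋃ C) ⊆ hull (T ∘ F)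
          hull-⊆ F∈C p∈ A∈F = p∈ (⟦⟧-from (Members C) (_ , F∈C , A∈F))

          stable : ∀ s x → s ∈ Φ ⊎ s ∈ hull (T ∘ ⋃ C) → x ∈ hull (T ∘ ⋃ C) →
            s ∙ x ∈ hull (Members C)
          stable s x (inj₁ s∈Φ) x∈ (F , F∈C , A∈F) = proj₂ (proj₂ (C⊆P F∈C)) s x
            (inj₁ s∈Φ) (hull-⊆ F∈C {x} x∈) A∈F
          stable s x (inj₂ s∈) x∈ (F , F∈C , A∈F) = proj₂ (proj₂ (C⊆P F∈C)) s x
            (inj₂ (hull-⊆ F∈C {s} s∈)) (hull-⊆ F∈C {x} x∈) A∈F

        module _ {E : Subset} (E-closed : Closed E) where
          hull⟦⋂⟧ : hull (T ∘ ⟦ ⋂ E ⟧) ⊆ E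
          hull⟦⋂⟧ {p} p∈ = E-closed λ {A} A∈⋂ → p∈ (⟦⟧-from (⋂ E) {A} λ {q} → A∈⋂ {q})

          ⟦⋂⟧-hull : E ⊆ hull (T ∘ ⟦ ⋂ E ⟧)
          ⟦⋂⟧-hull {p} p∈E {A} A∈ = ⟦⟧-to (⋂ E) {A} A∈ {p} p∈E

          fromClosed : Satisfiable E → Stable Φ E → ⟦ ⋂ E ⟧ ∈ P
          fromClosed E-sat E-stable =
            isFilter-respects
              ((λ {A} → ⟦⟧-from (⋂ E) {A}) , (λ {A} → ⟦⟧-to (⋂ E) {A}))
              (⋂-isFilter E-sat) ,
            (λ x → ⟦⟧-from (⋂ E) {φ x} λ {p} → φ∈⋂ E x {p}) ,
            stable
            where
            stable : Stable Φ (hull (T ∘ ⟦ ⋂ E ⟧))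
            stable s x (inj₁ s∈Φ) x∈ =
              ⟦⋂⟧-hull {s ∙ x} (E-stable s x (inj₁ s∈Φ) (hull⟦⋂⟧ {x} x∈))
            stable s x (inj₂ s∈) x∈ = ⟦⋂⟧-hull {s ∙ x}
              (E-stable s x (inj₂ (hull⟦⋂⟧ {s} s∈)) (hull⟦⋂⟧ {x} x∈))

        fromMaximal : ∃[ M ] ⟦ ⋂ D₀ ⟧ ⊑ M × M ∈ P × (∀ G → G ∈ P → M ⊑ G → G ⊑ M) →
          ∃[ D ] D ⊆ D₀ × Satisfiable D × Closed D × Stable Φ D ×
            (∀ E → E ⊆ D → Satisfiable E → Closed E → Stable Φ E → D ⊆ E)
        fromMaximal (M , F₀⊑M , (M-filter , φ∈M , M-stable) , maximal) =
          hull (T ∘ M) ,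
          (λ {p} p∈ → hull⟦⋂⟧ D₀-closed {p} λ {A} m → p∈ (F₀⊑M {A} m)) ,
          hull-satisfiable M-filter φ∈M ,
          (λ {p} p∈ {A} A∈M → p∈ λ {q} q∈ → q∈ A∈M) ,
          M-stable ,
          -- `E ⊆ hull (T ∘ M)` makes `⟦ ⋂ E ⟧` an extension of `M`; by maximality it adds nothing,
          -- so the hull of `M` lies in `E`.
          λ E E⊆ E-sat E-closed E-stable {p} p∈ → hull⟦⋂⟧ E-closed {p} λ {A} A∈⋂ →
            p∈ (maximal ⟦ ⋂ E ⟧ (fromClosed E-closed E-sat E-stable)
              (λ {B} B∈M → ⟦⟧-from (⋂ E) {B} λ {q} q∈E → E⊆ {q} q∈E B∈M) {A} A∈⋂)

    opaque
      -- Ellis' argument: for `x` in a minimal closed subsemigroup `D`, minimality gives first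
      -- `D = D ∙ x`, then that all of `D` stabilizes `x`. In particular `x` stabilizes itself.
      idempotent-in : ∀ D₀ → Closed D₀ → Satisfiable D₀ → Stable ∅ D₀ →
        ∃[ e ] e ∈ D₀ × e ∙ e ≋ e
      idempotent-in D₀ D₀-closed D₀-sat D₀-stable
        with D , D⊆ , (x , x∈D) , D-closed , D-stable , minimal
          ← minimalClosed ∅ D₀ D₀-closed D₀-sat D₀-stable
        = x , D⊆ {x} x∈D , proj₂ (D⊆stab {x} x∈D)
        where
        D∙x : Subset
        D∙x = D ∙⟨ x ⟩

        D∙x-stable : Stable ∅ D∙x
        D∙x-stable s t (inj₂ (s′ , s′∈D , s′x≈s)) (t′ , t′∈D , t′x≈t) =
          s ∙ t′ , D-stable s t′ (inj₂ s∈D) t′∈D ,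
          ≋-trans {s ∙ t′ ∙ x} {s ∙ (t′ ∙ x)} {s ∙ t} (assoc s t′ x)
            (∙-congˡ {s} {t′ ∙ x} {t} t′x≈t)
          where
          s∈D : s ∈ D
          s∈D = closed-respects (λ {p} → D-closed {p}) {s′ ∙ x} {s} s′x≈s
            (D-stable s′ x (inj₂ s′∈D) x∈D)

        D⊆D∙x : D ⊆ D∙x
        D⊆D∙x = minimal D∙x
          (λ { {q} (s , s∈D , sx≈q) → closed-respects (λ {p} → D-closed {p})
                 {s ∙ x} {q} sx≈q (D-stable s x (inj₂ s∈D) x∈D) })
          (x ∙ x , x , x∈D , ≋-refl {x ∙ x})
          (λ {p} → ∙⟨⟩-closed (λ {p} → D-closed {p}) x {p})
          D∙x-stable

        stab : Subset
        stab = D ∩ stabilizer x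

        stab-stable : Stable ∅ stab
        stab-stable s t (inj₂ (s∈D , sx≈x)) (t∈D , tx≈x) =
          D-stable s t (inj₂ s∈D) t∈D ,
          ≋-trans {s ∙ t ∙ x} {s ∙ (t ∙ x)} {x} (assoc s t x)
            (≋-trans {s ∙ (t ∙ x)} {s ∙ x} {x} (∙-congˡ {s} {t ∙ x} {x} tx≈x) sx≈x)

        D⊆stab : D ⊆ stab
        D⊆stab = minimal stab proj₁
          -- Membership of `x` in `D ∙ x` provides an `s` in `D` with `s ∙ x ≋ x`, a point of
          -- `stab`.
          (D⊆D∙x {x} x∈D)
          (λ {p} → ∩-closed {D} {stabilizer x} (λ {p} → D-closed {p})
            (λ {p} → stabilizer-closed x {p}) {p})
          stab-stable

    everything : Subset
    everything = U

    everything-closed : Closed everything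
    everything-closed _ = _

    opaque
      -- Take `m` in a minimal closed left ideal `D`. Each `δS ∙ (x ∙ m)` is a closed left ideal
      -- inside `D`, so it contains `m`. The given point shows that δS is nonempty.
      minimal-element : Point → ∃[ m ] ∀ x → ∃[ s ] s ∙ (x ∙ m) ≋ m
      minimal-element p
        with D , _ , (m , m∈D) , D-closed , D-stable , minimal
          ← minimalClosed U everything (λ {p} → everything-closed {p}) (p , _) _
        = m , λ x → let
            xm = x ∙ m
            s , _ , e = minimal (everything ∙⟨ xm ⟩)
              (λ { {q} (s , _ , e) → closed-respects (λ {p} → D-closed {p})
                     {s ∙ xm} {q} e (D-stable s xm (inj₁ _) (D-stable x m (inj₁ _) m∈D)) })
              (xm ∙ xm , xm , _ , ≋-refl {xm ∙ xm})
              (λ {p} → ∙⟨⟩-closed (λ {p} → everything-closed {p}) xm {p})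
              (λ { s t _ (t′ , _ , e) → s ∙ t′ , _ ,
                     ≋-trans {s ∙ t′ ∙ xm} {s ∙ (t′ ∙ xm)} {s ∙ t} (assoc s t′ xm)
                       (∙-congˡ {s} {t′ ∙ xm} {t} e) })
              {m} m∈D
          in s , e

    smallestIdeal : Point → ∃[ I ] IsSmallestIdeal (δ S) I
    smallestIdeal p = let m , minimal = minimal-element p in
      _ , smallestIdeal-generatedBy (δ S) m minimal

-- Transfer of smallest ideals and central sets along δS → δT

theorem5p6 : (∀ {ℓ} → ExcludedMiddle ℓ) → (∀ {a b} → Extensionality a b) →
    ∀ {ℓ} (S T : PartialSemigroup ℓ) →
    PartialSemigroup.Adequate S → PartialSemigroup.Commutative S →
    PartialSemigroup.Adequate T → PartialSemigroup.Commutative T →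
    (h : PartialSemigroup.Carrier S → PartialSemigroup.Carrier T) →
    IsHomomorphism S T h → Surjective _≡_ _≡_ h →
    image _≈_ (β h) (InDelta S) ≐ InDelta T →
    (image _≈_ (β h) (Kδ S) ≐ Kδ T)
    × (∀ (A : Pred (PartialSemigroup.Carrier S) ℓ) → Central S A → Central T (image _≡_ h A))
    × (∀ (A : Pred (PartialSemigroup.Carrier T) ℓ) → Central T A → Central S (h ⊢ A))
theorem5p6 em ext {ℓ} S T _ _ _ _ h h-homo _ (image⊆δT , δT⊆image) =
  ((λ {q} → image-K⊆ {q}) , (λ {q} → ⊆image-K {q})) , central-image , central-preimage
  where
  open Classical em ext
  open Delta S
  module δS = Semigroup (δ S)
  module δT = Semigroup (δ T)

  h̃ : δS.Carrier → δT.Carrier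
  h̃ (p , p∈δ) = β h p , image⊆δT {β h p} (p , p∈δ , (λ m → m) , λ m → m)

  h̃-cong : ∀ {p q} → p δS.≈ q → h̃ p δT.≈ h̃ q
  h̃-cong (p⊆q , q⊆p) = p⊆q , q⊆p

  -- Where `s ∗ t` is defined, `h` carries it to the product of `h s` and `h t`; this gives one
  -- inclusion, which suffices for ultrafilters.
  h̃-homo : ∀ p q → h̃ (p δS.∙ q) δT.≈ h̃ p δT.∙ h̃ q
  h̃-homo p q = ≈-of-⊆ {p = proj₁ (h̃ (p δS.∙ q))} {proj₁ (h̃ p δT.∙ h̃ q)}
    (upward (proj₁ p) λ {s} → upward (proj₁ q) λ {t} (u , st , m) →
      h u , h-homo s t st , m)

  h̃-onto : ∀ q → ∃[ p ] h̃ p δT.≈ q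
  h̃-onto (q , q∈δ) with p , p∈δ , e ← δT⊆image {q} q∈δ = (p , p∈δ) , e

  open SurjectiveHomomorphism (δ S) (δ T)

  image-smallest : ∀ {I} → IsSmallestIdeal (δ S) I →
    IsSmallestIdeal (δ T) (image δT._≈_ h̃ I)
  image-smallest = image-isSmallestIdeal h̃
    (λ {p} {q} → h̃-cong {p} {q}) h̃-homo h̃-onto

  -- The image of the smallest ideal of δS is an ideal of δT, so it contains the smallest ideal `J`
  -- and with it `q`.
  lift-smallest : ∀ q → q ∈ SmallestIdeal (δ T) →
    ∃[ p ] p ∈ SmallestIdeal (δ S) × h̃ p δT.≈ q
  lift-smallest q (J , (J-ideal , J-smallest) , q∈J) =
    let I , I-smallest = smallestIdeal (proj₁ (h̃-onto q))
        p , p∈I , e = J-smallest _ (proj₁ (image-smallest I-smallest)) q∈J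
    in p , (I , I-smallest , p∈I) , e

  image-K⊆ : image _≈_ (β h) (Kδ S) ⊆ Kδ T
  image-K⊆ {q} (p , (p∈δ , I , I-smallest , p∈I) , e) =
    image⊆δT {q} (p , p∈δ , e) ,
    image δT._≈_ h̃ I , image-smallest I-smallest , (p , p∈δ) , p∈I , e

  ⊆image-K : Kδ T ⊆ image _≈_ (β h) (Kδ S)
  ⊆image-K {q} (q∈δ , q∈K) with (p , p∈δ) , p∈K , e ← lift-smallest (q , q∈δ) q∈K =
    p , (p∈δ , p∈K) , e

  central-image : ∀ A → Central S A → Central T (image _≡_ h A)
  central-image A (p , (I , I-smallest , p∈I) , idem , A∈p) =
    h̃ p ,
    (image δT._≈_ h̃ I , image-smallest I-smallest , p , p∈I , δT.refl {h̃ p}) ,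
    δT.trans {h̃ p δT.∙ h̃ p} {h̃ (p δS.∙ p)} {h̃ p}
      (δT.sym {h̃ (p δS.∙ p)} {h̃ p δT.∙ h̃ p} (h̃-homo p p))
      (h̃-cong {p δS.∙ p} {p} idem) ,
    upward (proj₁ p) (λ {x} x∈A → x , x∈A , refl) A∈p

  module Fibre (p : δS.Carrier) (q : δT.Carrier) (p↦q : h̃ p δT.≈ q)
    (idem : q δT.∙ q δT.≈ q) where

    fibre : Subset
    fibre s = h̃ s δT.≈ q

    -- For `A` in `q`, the set `h ⊢ A` belongs to every point above `q`, hence to every limit of
    -- such points.
    fibre-closed : Closed fibre
    fibre-closed {s} s∈hull = δT.sym {q} {h̃ s}
      (≈-of-⊆ {p = proj₁ q} {proj₁ (h̃ s)} λ A∈q → s∈hull λ (_ , q⊆) → q⊆ A∈q)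

    fibre-∙ : ∀ s t → s ∈ fibre → t ∈ fibre → s δS.∙ t ∈ fibre
    fibre-∙ s t s↦q t↦q = δT.trans {h̃ (s δS.∙ t)} {h̃ s δT.∙ h̃ t} {q} (h̃-homo s t)
      (δT.trans {h̃ s δT.∙ h̃ t} {q δT.∙ q} {q}
        (δT.∙-cong {h̃ s} {q} {h̃ t} {q} s↦q t↦q) idem)

    D : Subset
    D = (everything ∙⟨ p ⟩) ∩ fibre

    D-stable : Stable ∅ D
    D-stable s t (inj₂ (_ , s↦q)) ((t′ , _ , t′p≈t) , t↦q) =
      (s δS.∙ t′ , _ , δS.trans {s δS.∙ t′ δS.∙ p} {s δS.∙ (t′ δS.∙ p)} {s δS.∙ t}
        (δS.assoc s t′ p) (δS.∙-congˡ {s} {t′ δS.∙ p} {t} t′p≈t)) ,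
      fibre-∙ s t s↦q t↦q

    idempotent : ∃[ e ] e ∈ D × e δS.∙ e δS.≈ e
    idempotent = idempotent-in D
      (λ {s} → ∩-closed {everything ∙⟨ p ⟩} {fibre}
        (λ {s} → ∙⟨⟩-closed (λ {s} → everything-closed {s}) p {s})
        (λ {s} → fibre-closed {s}) {s})
      -- `p ∙ p` lies in `δS ∙ p`, and it lies above `q` because `q` is idempotent.
      (p δS.∙ p , (p , _ , δS.refl {p δS.∙ p}) , fibre-∙ p p p↦q p↦q)
      D-stable

  central-preimage : ∀ A → Central T A → Central S (h ⊢ A)
  central-preimage A (q , q∈K , idem , A∈q)
    with p , (I , I-smallest , p∈I) , p↦q ← lift-smallest q q∈K
    with e , ((s , _ , sp≈e) , _ , q⊆) , e-idem ← Fibre.idempotent p q p↦q idem =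
    -- `e` is a left multiple of `p`, so it stays in the ideal `I`; lying above `q`, it contains
    -- `h ⊢ A`.
    e , (I , I-smallest , respects sp≈e (left s p∈I)) , e-idem , q⊆ A∈q
    where open IsIdeal (proj₁ I-smallest)
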